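{- Let $d \geq 1$, let $A, B \subseteq \mathbb{Z}^d$ be finite sets, and suppose that $U \subseteq \mathbb{Z}^d$ is contained in a quasicube. Then \[ |A + B + U| \geq |A|^{1/2} |B|^{1/2} |U|, \] where $A + B + U = \{a + b + u : a \in A, b \in B, u \in U\}$.
   Context: Quasicubes $\Sigma \subseteq \mathbb{Z}^d$ are defined inductively on $d$. When $d = 1$, a quasicube is simply a subset of $\mathbb{Z}$ of size two. For $d \geq 2$, $\Sigma \subseteq \mathbb{Z}^d$ is a quasicube if (1) $\pi(\Sigma) = \{x_0, x_1\}$ is a set of size two, where $\pi : \mathbb{Z}^d \to \mathbb{Z}$ is the coordinate projection onto the last coordinate, and (2) for each $i \in \{0,1\}$, the fibre $\Sigma_i := \Sigma \cap \pi^{ -1}(x_i)$, regarded as a subset of $\mathbb{Z}^{d-1}$ (by deleting the last coordinate), is a quasicube in $\mathbb{Z}^{d-1}$. For example, $\{0,1\}^d$ is a quasicube, as is $\{(0,0),(1,0),(0,1),(1,2)\} \subseteq \mathbb{Z}^2$. -}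

module Defs where

open import Data.Nat using (ℕ; zero; suc)
open import Data.Integer using (ℤ) renaming (_+_ to _+ℤ_)
import Data.Integer.Properties as ℤP
open import Data.Vec using (Vec; []; _∷_; _∷ʳ_; last; head; zipWith)
import Data.Vec.Properties as VecP
open import Data.List using (List; length; deduplicate; cartesianProductWith)
open import Data.Product using (Σ; ∃; _×_; _,_)
open import Data.Sum using (_⊎_)
open import Relation.Binary.PropositionalEquality using (_≡_)
open import Relation.Nullary using (¬_)

Point : ℕ → Set
Point d = Vec ℤ d

_⊕_ : ∀ {d} → Point d → Point d → Point d
_⊕_ = zipWith _+ℤ_

-- A finite set of points is represented by a list; its cardinality is the
-- number of distinct entries.
card : ∀ {d} → List (Point d) → ℕ
card xs = length (deduplicate (VecP.≡-dec ℤP._≟_) xs)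

sumset3 : ∀ {d} → List (Point d) → List (Point d) → List (Point d) → List (Point d)
sumset3 A B U = cartesianProductWith _⊕_ (cartesianProductWith _⊕_ A B) U

Quasicube : (d : ℕ) → (Point (suc d) → Set) → Set
Quasicube zero S =
  Σ ℤ λ x₀ → Σ ℤ λ x₁ → ¬ (x₀ ≡ x₁) ×
    ((v : Point 1) → (S v → (head v ≡ x₀ ⊎ head v ≡ x₁))
                   × ((head v ≡ x₀ ⊎ head v ≡ x₁) → S v))
Quasicube (suc k) S =
  Σ ℤ λ x₀ → Σ ℤ λ x₁ → ¬ (x₀ ≡ x₁) ×
    ((v : Point (suc (suc k))) → S v → (last v ≡ x₀ ⊎ last v ≡ x₁)) ×
    (∃ λ v → S v × last v ≡ x₀) ×
    (∃ λ v → S v × last v ≡ x₁) ×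
    Quasicube k (λ w → S (w ∷ʳ x₀)) ×
    Quasicube k (λ w → S (w ∷ʳ x₁))

{-# OPTIONS --safe #-}

-- Slice along the last coordinate.  With p ≥ q the sizes of the two fibres of U, and a(x)², b(y)² those
-- of the fibres of A and B, induction on the dimension reduces the theorem to
--   ∑_z max (p c(z), q c(z − t)) ≥ (p + q) ‖a‖₂ ‖b‖₂,   where c(z) = max_{x + y = z} a(x) b(y),
-- and splitting A and B into residue classes modulo t reduces this to t = 1.
--
-- For t = 1 this is a Prékopa–Leindler inequality after tilting by powers of r = q / p: transport the
-- mass of a² monotonically onto that of b², the position within a unit cell being measured by the
-- variable s ∈ [r, 1] for which mass is linear in s².  A piece of the path inside the cell (x, y) going
-- from (s, s′) to (u, u′) contributes a(x) b(y) (s s′ − u u′), which is at least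
-- a(x) b(y) √((s² − u²)(s′² − u′²)), i.e. proportional to the transported mass.
--
-- Square roots are replaced by integer square roots, whose errors disappear after rescaling the masses.
module Submission where

open import Defs
open import Data.Nat using (ℕ; zero; suc; _+_; _*_; _∸_; _⊔_; _≤_; _<_; _≤?_; z≤n; s≤s; >-nonZero)
open import Data.Nat.Properties
open import Data.Nat.ListAction using (sum)
open import Data.Nat.ListAction.Properties using (sum-++)
open import Data.Nat.Tactic.RingSolver using (solve-∀)
open import Data.Integer as ℤ using (ℤ; +_; ∣_∣) renaming (_+_ to _+ℤ_; _-_ to _-ℤ_; _*_ to _*ℤ_)
import Data.Integer.DivMod as ℤD
import Data.Integer.Properties as ℤP
import Data.Integer.Tactic.RingSolver as ℤSolver
open import Data.Fin using (Fin; toℕ; fromℕ<)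
import Data.Fin.Properties as FinP
open import Data.Vec using ([]; _∷_; _∷ʳ_; init; last; initLast)
import Data.Vec.Properties as VecP
open import Data.List
  using (List; []; _∷_; _++_; length; map; applyUpTo; upTo; allFin; filter; deduplicate; cartesianProductWith)
import Data.List.Properties as ListP
open import Data.List.Extrema ≤-totalOrder using (argmax; f[⊥]≤f[argmax]; f[xs]≤f[argmax])
open import Data.List.Membership.Propositional using (_∈_)
open import Data.List.Membership.Propositional.Properties
open import Data.List.Relation.Binary.Subset.Propositional using (_⊆_)
open import Data.List.Relation.Unary.All as All using (All; []; _∷_)
open import Data.List.Relation.Unary.AllPairs using ([]; _∷_)
open import Data.List.Relation.Unary.Any using (here; there)
open import Data.List.Relation.Unary.Unique.DecPropositional.Properties using (deduplicate-!)
open import Data.List.Relation.Unary.Unique.Propositional using (Unique)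
open import Data.List.Relation.Unary.Unique.Propositional.Properties
  using (++⁺; map⁺; cartesianProductWith⁺; allFin⁺; upTo⁺)
open import Data.Product using (_×_; _,_; proj₁; proj₂; ∃)
open import Data.Sum using (_⊎_; inj₁; inj₂; swap)
open import Function using (_∘_; id)
open import Relation.Binary.PropositionalEquality
open import Relation.Nullary using (Dec; yes; no; contradiction)

-- Integer square roots

sq-cancel-≤ : ∀ {x y} → x * x ≤ y * y → x ≤ y
sq-cancel-≤ {x} {y} h = ≮⇒≥ (λ y<x → <⇒≱ (*-mono-< y<x y<x) h)

isqrt : ℕ → ℕ
isqrt zero = 0
isqrt (suc n) with suc (isqrt n) * suc (isqrt n) ≤? suc n
... | yes _ = suc (isqrt n)
... | no _ = isqrt n

isqrt-sq≤ : ∀ n → isqrt n * isqrt n ≤ n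
isqrt-sq≤ zero = z≤n
isqrt-sq≤ (suc n) with suc (isqrt n) * suc (isqrt n) ≤? suc n
... | yes h = h
... | no _ = m≤n⇒m≤1+n (isqrt-sq≤ n)

<-suc-isqrt-sq : ∀ n → n < suc (isqrt n) * suc (isqrt n)
<-suc-isqrt-sq zero = s≤s z≤n
<-suc-isqrt-sq (suc n) with suc (isqrt n) * suc (isqrt n) ≤? suc n
... | no h = ≰⇒> h
... | yes h = ≤-<-trans (<-suc-isqrt-sq n)
                (*-mono-< (n<1+n (suc (isqrt n))) (n<1+n (suc (isqrt n))))

sq≤⇒≤isqrt : ∀ {x n} → x * x ≤ n → x ≤ isqrt n
sq≤⇒≤isqrt {x} {n} h = ≮⇒≥ λ lt → <⇒≱ (<-suc-isqrt-sq n) (≤-trans (*-mono-≤ lt lt) h)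

≤sq⇒isqrt≤ : ∀ {n x} → n ≤ x * x → isqrt n ≤ x
≤sq⇒isqrt≤ {n} h = sq-cancel-≤ (≤-trans (isqrt-sq≤ n) h)

isqrt-mono : ∀ {x y} → x ≤ y → isqrt x ≤ isqrt y
isqrt-mono {x} h = sq≤⇒≤isqrt (≤-trans (isqrt-sq≤ x) h)

4xy≤[x+y]² : ∀ x y → 4 * (x * y) ≤ (x + y) * (x + y)
4xy≤[x+y]² x y with ≤-total x y
... | inj₁ x≤y with k , refl ← m≤n⇒∃[o]m+o≡n x≤y =
  subst (4 * (x * (x + k)) ≤_) (eq x k) (m≤m+n _ (k * k))
  where eq : ∀ x k → 4 * (x * (x + k)) + k * k ≡ (x + (x + k)) * (x + (x + k))
        eq = solve-∀
... | inj₂ y≤x with k , refl ← m≤n⇒∃[o]m+o≡n y≤x =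
  subst (4 * ((y + k) * y) ≤_) (eq y k) (m≤m+n _ (k * k))
  where eq : ∀ y k → 4 * ((y + k) * y) + k * k ≡ ((y + k) + y) * ((y + k) + y)
        eq = solve-∀

-- A reversed Cauchy–Schwarz inequality; rounding costs nothing here, unlike in isqrt-rearrange.
isqrt-shift : ∀ x y z → isqrt (x * y) + z ≤ isqrt ((x + z) * (y + z))
isqrt-shift x y z = sq≤⇒≤isqrt (begin
  (s + z) * (s + z)                   ≡⟨ eq₁ s z ⟩
  s * s + z * (2 * s) + z * z         ≤⟨ +-monoˡ-≤ (z * z) (+-mono-≤ (isqrt-sq≤ (x * y)) (*-monoʳ-≤ z am-gm)) ⟩
  x * y + z * (x + y) + z * z         ≡⟨ eq₂ x y z ⟩
  (x + z) * (y + z)                   ∎)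
  where
  open ≤-Reasoning
  s = isqrt (x * y)
  eq₁ : ∀ s z → (s + z) * (s + z) ≡ s * s + z * (2 * s) + z * z
  eq₁ = solve-∀
  eq₂ : ∀ x y z → x * y + z * (x + y) + z * z ≡ (x + z) * (y + z)
  eq₂ = solve-∀
  eq₃ : ∀ s → (2 * s) * (2 * s) ≡ 4 * (s * s)
  eq₃ = solve-∀
  am-gm : 2 * s ≤ x + y
  am-gm = sq-cancel-≤ (≤-trans (≤-reflexive (eq₃ s))
            (≤-trans (*-monoʳ-≤ 4 (isqrt-sq≤ (x * y))) (4xy≤[x+y]² x y)))

-- After squaring, the rearrangement inequality u c + w b ≤ u b + w c compares the squares, and the
-- mixed products agree because (u c)(w b) = (u b)(w c). Rounding up the two roots on the right
-- costs the 2.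
isqrt-rearrange : ∀ {u w b c} → u ≤ w → b ≤ c →
  isqrt (u * c) + isqrt (w * b) ≤ isqrt (u * b) + isqrt (w * c) + 2
isqrt-rearrange {u} {w} {b} {c} u≤w b≤c =
  ≤-trans (sq-cancel-≤ (begin
    (r₁ + r₂) * (r₁ + r₂)               ≡⟨ eq₁ r₁ r₂ ⟩
    r₁ * r₁ + r₂ * r₂ + 2 * (r₁ * r₂)   ≤⟨ +-mono-≤ (+-mono-≤ (isqrt-sq≤ (u * c)) (isqrt-sq≤ (w * b)))
                                                    (*-monoʳ-≤ 2 cross) ⟩
    u * c + w * b + 2 * (y₁ * y₂)       ≤⟨ +-monoˡ-≤ (2 * (y₁ * y₂)) rearrange ⟩
    u * b + w * c + 2 * (y₁ * y₂)       ≤⟨ +-monoˡ-≤ (2 * (y₁ * y₂)) (+-mono-≤ (<⇒≤ (<-suc-isqrt-sq (u * b))) (<⇒≤ (<-suc-isqrt-sq (w * c)))) ⟩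
    y₁ * y₁ + y₂ * y₂ + 2 * (y₁ * y₂)   ≡⟨ eq₁ y₁ y₂ ⟨
    (y₁ + y₂) * (y₁ + y₂)               ∎))
  (≤-reflexive (eq₂ (isqrt (u * b)) (isqrt (w * c))))
  where
  open ≤-Reasoning
  r₁ = isqrt (u * c)
  r₂ = isqrt (w * b)
  y₁ = suc (isqrt (u * b))
  y₂ = suc (isqrt (w * c))
  eq₁ : ∀ x y → (x + y) * (x + y) ≡ x * x + y * y + 2 * (x * y)
  eq₁ = solve-∀
  eq₂ : ∀ x y → suc x + suc y ≡ x + y + 2
  eq₂ = solve-∀
  exch : ∀ u c w b → (u * c) * (w * b) ≡ (u * b) * (w * c)
  exch = solve-∀
  inter : ∀ x y → (x * y) * (x * y) ≡ (x * x) * (y * y)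
  inter = solve-∀
  cross : r₁ * r₂ ≤ y₁ * y₂
  cross = sq-cancel-≤ (begin
    (r₁ * r₂) * (r₁ * r₂)   ≡⟨ inter r₁ r₂ ⟩
    (r₁ * r₁) * (r₂ * r₂)   ≤⟨ *-mono-≤ (isqrt-sq≤ (u * c)) (isqrt-sq≤ (w * b)) ⟩
    (u * c) * (w * b)       ≡⟨ exch u c w b ⟩
    (u * b) * (w * c)       ≤⟨ *-mono-≤ (<⇒≤ (<-suc-isqrt-sq (u * b))) (<⇒≤ (<-suc-isqrt-sq (w * c))) ⟩
    (y₁ * y₁) * (y₂ * y₂)   ≡⟨ inter y₁ y₂ ⟨
    (y₁ * y₂) * (y₁ * y₂)   ∎)
  rearrange : u * c + w * b ≤ u * b + w * c
  rearrange with k , refl ← m≤n⇒∃[o]m+o≡n u≤w | l , refl ← m≤n⇒∃[o]m+o≡n b≤c =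
    subst (u * (b + l) + (u + k) * b ≤_) (eq u b k l) (m≤m+n _ (k * l))
    where eq : ∀ u b k l → u * (b + l) + (u + k) * b + k * l ≡ u * b + (u + k) * (b + l)
          eq = solve-∀

-- The one-dimensional inequality

∑< : ℕ → (ℕ → ℕ) → ℕ
∑< n f = sum (applyUpTo f n)

-- In the application `α` and `β` count the points in fibres of A and B, `X` those in fibres of A +
-- B + U, and `at` and `at⁺` come from the two fibres of U, of sizes `p` and `q`.
record Dominates (p q : ℕ) (α β X : ℕ → ℕ) : Set where
  constructor dom
  field
    at  : ∀ i j → (p * p) * (α i * β j) ≤ X (i + j) * X (i + j)
    at⁺ : ∀ i j → (q * q) * (α i * β j) ≤ X (suc (i + j)) * X (suc (i + j))
open Dominates

module Path (q d : ℕ) where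

  -- `d` is p - q and `c₀` is p² - q², both without subtraction.
  p c₀ : ℕ
  p = q + d
  c₀ = d * (p + q)


  -- Split p √(wβ) as (p - q) √(wβ) + q √(wβ) and bound the first root by `x`. The final `p` pays
  -- for rounding √(wβ) up.
  stretch : ∀ w β x → w * β ≤ x * x →
    isqrt (w * ((p * p) * β)) ≤ d * x + isqrt (w * ((q * q) * β)) + p
  stretch w β x wβ≤x² = begin
    isqrt (w * ((p * p) * β))                ≤⟨ ≤sq⇒isqrt≤ (≤-trans (≤-reflexive (eq₁ w β p))
                                                 (≤-trans (*-monoʳ-≤ (p * p) (<⇒≤ (<-suc-isqrt-sq (w * β))))
                                                   (≤-reflexive (eq₂ p (suc s))))) ⟩
    p * suc s                                ≡⟨ eq₃ q d s ⟩
    d * s + q * s + p                        ≤⟨ +-monoˡ-≤ p (+-mono-≤ (*-monoʳ-≤ d (≤sq⇒isqrt≤ wβ≤x²))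
                                                 (sq≤⇒≤isqrt (≤-trans (≤-reflexive (sym (eq₂ q s)))
                                                   (≤-trans (*-monoʳ-≤ (q * q) (isqrt-sq≤ (w * β)))
                                                     (≤-reflexive (sym (eq₁ w β q))))))) ⟩
    d * x + isqrt (w * ((q * q) * β)) + p    ∎
    where
    open ≤-Reasoning
    s = isqrt (w * β)
    eq₁ : ∀ w β p → w * ((p * p) * β) ≡ (p * p) * (w * β)
    eq₁ = solve-∀
    eq₂ : ∀ p s → (p * p) * (s * s) ≡ (p * s) * (p * s)
    eq₂ = solve-∀
    eq₃ : ∀ q d s → (q + d) * suc s ≡ d * s + q * s + (q + d)
    eq₃ = solve-∀

  -- Up to rounding this is √w (p√β - √P) + √u (√P - q√β) ≤ (p - q) x. Both brackets are nonnegative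
  -- with sum (p - q)√β, so the smaller of √u and √w may be replaced by the larger, and then
  -- `stretch` applies.
  transition : ∀ u w β P x →
    (q * q) * β ≤ P → P ≤ (p * p) * β → u * β ≤ x * x → w * β ≤ x * x →
    isqrt (u * P) + isqrt (w * ((p * p) * β)) ≤
      d * x + isqrt (u * ((q * q) * β)) + isqrt (w * P) + (2 + p)
  transition u w β P x lo hi uβ≤ wβ≤ with ≤-total u w
  ... | inj₁ u≤w = begin
    isqrt (u * P) + isqrt (w * p²β)                      ≤⟨ +-monoʳ-≤ (isqrt (u * P)) (stretch w β x wβ≤) ⟩
    isqrt (u * P) + (d * x + isqrt (w * q²β) + p)        ≡⟨ eq₁ (isqrt (u * P)) (d * x) (isqrt (w * q²β)) p ⟩
    isqrt (u * P) + isqrt (w * q²β) + (d * x + p)        ≤⟨ +-monoˡ-≤ (d * x + p) (isqrt-rearrange u≤w lo) ⟩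
    isqrt (u * q²β) + isqrt (w * P) + 2 + (d * x + p)    ≡⟨ eq₂ (isqrt (u * q²β)) (isqrt (w * P)) (d * x) p ⟩
    d * x + isqrt (u * q²β) + isqrt (w * P) + (2 + p)    ∎
    where
    open ≤-Reasoning
    p²β = (p * p) * β
    q²β = (q * q) * β
    eq₁ : ∀ a b c e → a + (b + c + e) ≡ a + c + (b + e)
    eq₁ = solve-∀
    eq₂ : ∀ a b c e → a + b + 2 + (c + e) ≡ c + a + b + (2 + e)
    eq₂ = solve-∀
  ... | inj₂ w≤u = begin
    isqrt (u * P) + isqrt (w * p²β)                      ≡⟨ +-comm (isqrt (u * P)) (isqrt (w * p²β)) ⟩
    isqrt (w * p²β) + isqrt (u * P)                      ≤⟨ isqrt-rearrange w≤u hi ⟩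
    isqrt (w * P) + isqrt (u * p²β) + 2                  ≤⟨ +-monoˡ-≤ 2 (+-monoʳ-≤ (isqrt (w * P)) (stretch u β x uβ≤)) ⟩
    isqrt (w * P) + (d * x + isqrt (u * q²β) + p) + 2    ≡⟨ eq (isqrt (w * P)) (d * x) (isqrt (u * q²β)) p ⟩
    d * x + isqrt (u * q²β) + isqrt (w * P) + (2 + p)    ∎
    where
    open ≤-Reasoning
    p²β = (p * p) * β
    q²β = (q * q) * β
    eq : ∀ a b c e → a + (b + c + e) + 2 ≡ b + c + a + (2 + e)
    eq = solve-∀

  -- This is p² s² (a + e) for the position s in a cell with mass `a` left and `e` transported: it
  -- falls linearly from p² (a + e) to q² (a + e), by `c₀` per unit of mass.
  mix : ℕ → ℕ → ℕ
  mix a e = (p * p) * a + (q * q) * e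

  mix-consume : ∀ a b e → mix (a + b) e ≡ mix b (e + a) + c₀ * a
  mix-consume a b e = eq q d a b e
    where
    eq : ∀ q d a b e → ((q + d) * (q + d)) * (a + b) + (q * q) * e ≡
           ((q + d) * (q + d)) * b + (q * q) * (e + a) + d * (q + d + q) * a
    eq = solve-∀

  q²≤p² : q * q ≤ p * p
  q²≤p² = *-mono-≤ (m≤m+n q d) (m≤m+n q d)

  mix≥ : ∀ a e → (q * q) * (a + e) ≤ mix a e
  mix≥ a e = ≤-trans (≤-reflexive (*-distribˡ-+ (q * q) a e)) (+-monoˡ-≤ _ (*-monoˡ-≤ a q²≤p²))

  mix≤ : ∀ a e → mix a e ≤ (p * p) * (a + e)
  mix≤ a e = ≤-trans (+-monoʳ-≤ _ (*-monoˡ-≤ e q²≤p²)) (≤-reflexive (sym (*-distribˡ-+ (p * p) a e)))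

  -- A state of the north-west-corner coupling of α and β: a and b are what is left of the heads
  -- α 0 and β 0, while e and f have been transported already.  Modulo rounding, the bound says that
  -- p² − q² times the mass still to be transported is at most p − q times the part of ∑ X that is still
  -- available; only a fraction of X 0 is, and it contributes √(mix a e · mix b f) − p q √(α 0 · β 0) to
  -- the right-hand side.  Terms are moved so that no subtraction occurs.
  PathBound : (m n a e b f : ℕ) (α β X : ℕ → ℕ) → Set
  PathBound m n a e b f α β X =
    α 0 ≡ a + e → β 0 ≡ b + f →
    a + ∑< m (α ∘ suc) ≡ b + ∑< n (β ∘ suc) →
    Dominates p q α β X →
    c₀ * (a + ∑< m (α ∘ suc)) + isqrt ((q * q) * α 0 * ((p * p) * β 0)) ≤
      isqrt (mix a e * mix b f) + d * ∑< (suc (m + n)) (X ∘ suc) + (2 + p) * suc (m + n)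

  -- The rest `a` of α 0 goes to β 0, which has enough room. Inside the cell `isqrt-shift` accounts
  -- for `c₀ * a`; the passage to the next cell of `α` is paid for by X 1.
  step : ∀ m n α β X a e b′ f →
    (∀ m′ → m ≡ suc m′ → PathBound m′ n (α 1) 0 b′ (f + a) (α ∘ suc) β (X ∘ suc)) →
    PathBound m n a e (a + b′) f α β X
  step m n α β X a e b′ f ih α₀≡ β₀≡ bal D = begin
    c₀ * (a + Sₘ) + isqrt (w * ((p * p) * β 0))      ≡⟨ eq₁ c₀ a Sₘ (isqrt (w * ((p * p) * β 0))) ⟩
    c₀ * Sₘ + isqrt (w * ((p * p) * β 0)) + c₀ * a   ≤⟨ +-monoˡ-≤ (c₀ * a) (rest m refl) ⟩
    isqrt (w * P) + R + c₀ * a                       ≡⟨ eq₂ (isqrt (w * P)) R (c₀ * a) ⟩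
    isqrt (w * P) + c₀ * a + R                       ≤⟨ +-monoˡ-≤ R (isqrt-shift w P (c₀ * a)) ⟩
    isqrt ((w + c₀ * a) * (P + c₀ * a)) + R          ≡⟨ cong (_+ R) (cong isqrt (cong₂ _*_ w≡ (sym (mix-consume a b′ f)))) ⟩
    isqrt (mix a e * mix (a + b′) f) + R             ≡⟨ +-assoc (isqrt (mix a e * mix (a + b′) f)) _ _ ⟨
    isqrt (mix a e * mix (a + b′) f) + d * ∑< (suc (m + n)) (X ∘ suc) + (2 + p) * suc (m + n) ∎
    where
    open ≤-Reasoning
    Sₘ w P R : ℕ
    Sₘ = ∑< m (α ∘ suc)
    -- `w` is the value of `mix` at which α 0 is used up, and `P` the value then reached in the cell
    -- β 0.
    w = (q * q) * α 0
    P = mix b′ (f + a)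
    R = d * ∑< (suc (m + n)) (X ∘ suc) + (2 + p) * suc (m + n)
    eq₁ : ∀ c a S r → c * (a + S) + r ≡ c * S + r + c * a
    eq₁ = solve-∀
    eq₂ : ∀ s r k → s + r + k ≡ s + k + r
    eq₂ = solve-∀
    w≡ : w + c₀ * a ≡ mix a e
    w≡ = begin-equality
      (q * q) * α 0 + c₀ * a     ≡⟨ cong (λ z → (q * q) * z + c₀ * a) α₀≡ ⟩
      (q * q) * (a + e) + c₀ * a ≡⟨ eq q d a e ⟩
      mix a e ∎
      where
      eq : ∀ q d a e → (q * q) * (a + e) + d * (q + d + q) * a ≡ ((q + d) * (q + d)) * a + (q * q) * e
      eq = solve-∀
    β₀≡′ : β 0 ≡ b′ + (f + a)
    β₀≡′ = trans β₀≡ (eq a b′ f)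
      where
      eq : ∀ a b f → a + b + f ≡ b + (f + a)
      eq = solve-∀
    bal′ : Sₘ ≡ b′ + ∑< n (β ∘ suc)
    bal′ = +-cancelˡ-≡ a _ _ (trans bal (+-assoc a b′ _))
    lo : (q * q) * β 0 ≤ P
    lo = subst (λ z → (q * q) * z ≤ P) (sym β₀≡′) (mix≥ b′ (f + a))
    hi : P ≤ (p * p) * β 0
    hi = subst (λ z → P ≤ (p * p) * z) (sym β₀≡′) (mix≤ b′ (f + a))
    w-dom : w * β 0 ≤ X 1 * X 1
    w-dom = ≤-trans (≤-reflexive (*-assoc (q * q) (α 0) (β 0))) (at⁺ D 0 0)
    rest : ∀ m′ → m ≡ m′ → c₀ * ∑< m (α ∘ suc) + isqrt (w * ((p * p) * β 0)) ≤ isqrt (w * P) + R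
    -- With no further cell of `α` the path ends here, and `stretch` is enough because P ≥ q² β 0.
    rest zero refl = begin
      c₀ * 0 + isqrt (w * ((p * p) * β 0))             ≡⟨ cong (_+ isqrt (w * ((p * p) * β 0))) (*-zeroʳ c₀) ⟩
      isqrt (w * ((p * p) * β 0))                      ≤⟨ stretch w (β 0) (X 1) w-dom ⟩
      d * X 1 + isqrt (w * ((q * q) * β 0)) + p        ≤⟨ +-mono-≤ (+-mono-≤ (*-monoʳ-≤ d (m≤m+n (X 1) _)) (isqrt-mono (*-monoʳ-≤ w lo)))
                                                           (≤-trans (m≤n+m p 2) (m≤m*n (2 + p) (suc n))) ⟩
      d * ∑< (suc n) (X ∘ suc) + isqrt (w * P) + (2 + p) * suc n ≡⟨ eq (d * ∑< (suc n) (X ∘ suc)) (isqrt (w * P)) _ ⟩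
      isqrt (w * P) + R                                ∎
      where
      eq : ∀ x y z → x + y + z ≡ y + (x + z)
      eq = solve-∀
    -- Once the boundary terms of the next cell are added to both sides, the claim is the sum of
    -- `transition` and the induction hypothesis.
    rest (suc m′) refl = +-cancelˡ-≤ (isqrt (u * P) + isqrt (u * ((q * q) * β 0))) _ _ (begin
      isqrt (u * P) + isqrt (u * q²β) + (c₀ * Sₘ + isqrt (w * p²β))
        ≡⟨ eq₃ (isqrt (u * P)) (isqrt (u * q²β)) (c₀ * Sₘ) (isqrt (w * p²β)) ⟩
      (isqrt (u * P) + isqrt (w * p²β)) + (c₀ * Sₘ + isqrt (u * q²β))
        ≤⟨ +-mono-≤ (transition u w (β 0) P (X 1) lo hi u-dom w-dom) next ⟩
      (d * X 1 + isqrt (u * q²β) + isqrt (w * P) + (2 + p)) + (isqrt (u * P) + d * T + (2 + p) * suc (m′ + n))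
        ≡⟨ eq₄ d (X 1) (isqrt (u * q²β)) (isqrt (w * P)) (2 + p) (isqrt (u * P)) T (suc (m′ + n)) ⟩
      isqrt (u * P) + isqrt (u * q²β) + (isqrt (w * P) + R) ∎)
      where
      u p²β q²β T : ℕ
      u = (p * p) * α 1
      p²β = (p * p) * β 0
      q²β = (q * q) * β 0
      T = ∑< (suc (m′ + n)) (X ∘ suc ∘ suc)
      eq₃ : ∀ x y z t → x + y + (z + t) ≡ (x + t) + (z + y)
      eq₃ = solve-∀
      eq₄ : ∀ d x s t k r T l → (d * x + s + t + k) + (r + d * T + k * l) ≡ r + s + (t + (d * (x + T) + k * suc l))
      eq₄ = solve-∀
      u-dom : u * β 0 ≤ X 1 * X 1
      u-dom = ≤-trans (≤-reflexive (*-assoc (p * p) (α 1) (β 0))) (at D 1 0)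
      prod : ∀ q p x y → (q * q) * x * ((p * p) * y) ≡ (p * p) * x * ((q * q) * y)
      prod = solve-∀
      mix0 : mix (α 1) 0 ≡ u
      mix0 = trans (cong (λ z → u + z) (*-zeroʳ (q * q))) (+-identityʳ u)
      next : c₀ * Sₘ + isqrt (u * q²β) ≤ isqrt (u * P) + d * T + (2 + p) * suc (m′ + n)
      next = subst₂ (λ x y → c₀ * Sₘ + isqrt x ≤ isqrt (y * P) + d * T + (2 + p) * suc (m′ + n))
        (prod q p (α 1) (β 0)) mix0
        (ih m′ refl (sym (+-identityʳ (α 1))) β₀≡′ bal′ (dom (λ i j → at D (suc i) j) (λ i j → at⁺ D (suc i) j)))

  swap-dominates : ∀ {α β X} → Dominates p q α β X → Dominates p q β α X
  swap-dominates {α} {β} {X} D = dom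
    (λ i j → subst₂ (λ x k → (p * p) * x ≤ X k * X k) (*-comm (α j) (β i)) (+-comm j i) (at D j i))
    (λ i j → subst₂ (λ x k → (q * q) * x ≤ X (suc k) * X (suc k)) (*-comm (α j) (β i)) (+-comm j i) (at⁺ D j i))

  swap-path : ∀ {m n a e b f α β X} → PathBound m n a e b f α β X → PathBound n m b f a e β α X
  swap-path {m} {n} {a} {e} {b} {f} {α} {β} {X} h β₀≡ α₀≡ bal D =
    subst₂ _≤_
      (cong₂ (λ x y → c₀ * x + isqrt y) (sym bal) (prod q p (α 0) (β 0)))
      (cong₂ (λ x k → isqrt x + d * ∑< (suc k) (X ∘ suc) + (2 + p) * suc k) (*-comm (mix a e) (mix b f)) (+-comm m n))
      (h α₀≡ β₀≡ (sym bal) (swap-dominates D))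
    where
    prod : ∀ q p x y → (q * q) * x * ((p * p) * y) ≡ (q * q) * y * ((p * p) * x)
    prod = solve-∀

  -- Induction on the number `l` of cells not yet entered. The head with less mass left is exhausted
  -- first; if it is β 0, the roles of `α` and `β` are exchanged.
  path : ∀ l m n → m + n ≡ l → ∀ α β X a e b f → PathBound m n a e b f α β X
  path l m n m+n≡l α β X a e b f with ≤-total a b
  path l m n m+n≡l α β X a e b f | inj₁ a≤b with b′ , refl ← m≤n⇒∃[o]m+o≡n a≤b =
    step m n α β X a e b′ f (ih l m+n≡l)
    where
    ih : ∀ l → m + n ≡ l → ∀ m′ → m ≡ suc m′ → PathBound m′ n (α 1) 0 b′ (f + a) (α ∘ suc) β (X ∘ suc)
    ih (suc l) eq m′ refl = path l m′ n (suc-injective eq) (α ∘ suc) β (X ∘ suc) (α 1) 0 b′ (f + a)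
  path l m n m+n≡l α β X a e b f | inj₂ b≤a with a′ , refl ← m≤n⇒∃[o]m+o≡n b≤a =
    swap-path {n} {m} (step n m β α X b f a′ e (ih l m+n≡l))
    where
    ih : ∀ l → m + n ≡ l → ∀ n′ → n ≡ suc n′ → PathBound n′ m (β 1) 0 a′ (e + b) (β ∘ suc) α (X ∘ suc)
    ih zero eq n′ refl = contradiction eq (m+1+n≢0 m)
    ih (suc l) eq n′ refl = path l n′ m (suc-injective (trans (cong suc (+-comm n′ m)) (trans (sym (+-suc m n′)) eq)))
                              (β ∘ suc) α (X ∘ suc) (β 1) 0 a′ (e + b)

-- Rescaling and removal of the rounding errors

∑<-cong : ∀ n {f g : ℕ → ℕ} → (∀ i → f i ≡ g i) → ∑< n f ≡ ∑< n g
∑<-cong zero h = refl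
∑<-cong (suc n) h = cong₂ _+_ (h 0) (∑<-cong n (h ∘ suc))

∑<-*ʳ : ∀ n (f : ℕ → ℕ) k → ∑< n (λ i → f i * k) ≡ ∑< n f * k
∑<-*ʳ zero f k = refl
∑<-*ʳ (suc n) f k = trans (cong (λ z → f 0 * k + z) (∑<-*ʳ n (f ∘ suc) k)) (sym (*-distribʳ-+ k (f 0) (∑< n (f ∘ suc))))

-- If Q ≥ S² + 1, then y² would be at most 2 S C y + C², which fails for large `y`. An error `C`
-- chosen independently of `y` thus disappears.
≤sq-of-large : ∀ Q S C y → 2 * S * C + C * C < y → Q * (y * y) ≤ (S * y + C) * (S * y + C) → Q ≤ S * S
≤sq-of-large Q S C y large h = ≮⇒≥ λ S²<Q → <⇒≱ (begin-strict
  (S * y + C) * (S * y + C)                               ≡⟨ eq₁ S y C ⟩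
  S * S * (y * y) + (2 * S * C * y + C * C * 1)           ≤⟨ +-monoʳ-≤ (S * S * (y * y)) (+-monoʳ-≤ (2 * S * C * y)
                                                                (*-monoʳ-≤ (C * C) (≤-trans (s≤s z≤n) large))) ⟩
  S * S * (y * y) + (2 * S * C * y + C * C * y)           ≡⟨ cong (λ z → S * S * (y * y) + z) (*-distribʳ-+ y (2 * S * C) (C * C)) ⟨
  S * S * (y * y) + (2 * S * C + C * C) * y               <⟨ +-monoʳ-< (S * S * (y * y)) (*-monoˡ-< y {{>-nonZero (≤-trans (s≤s z≤n) large)}} large) ⟩
  S * S * (y * y) + y * y                                 ≡⟨ +-comm (S * S * (y * y)) (y * y) ⟩
  suc (S * S) * (y * y)                                   ≤⟨ *-monoˡ-≤ (y * y) S²<Q ⟩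
  Q * (y * y)                                             ∎) h
  where
  open ≤-Reasoning
  eq₁ : ∀ S y C → (S * y + C) * (S * y + C) ≡ S * S * (y * y) + (2 * S * C * y + C * C * 1)
  eq₁ = solve-∀

-- The inequality ∑ N ≥ (p + q) √(∑ α · ∑ β), squared. The m + n + 2 terms of `N` are those reached
-- by `at` and `at⁺`.
WeightedSum : ℕ → ℕ → Set
WeightedSum p q = ∀ m n (α β N : ℕ → ℕ) → Dominates p q α β N →
  ∑< (suc m) α * ∑< (suc n) β * ((p + q) * (p + q)) ≤ ∑< (suc (suc (m + n))) N * ∑< (suc (suc (m + n))) N

-- The sequences are rescaled to the common mass K M, and M is taken so large that the rounding
-- errors of isqrt, which do not depend on M, become irrelevant.
weighted-sum-< : ∀ q d → WeightedSum (q + suc d) q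
weighted-sum-< q d′ m n α β N D with ∑< (suc m) α * ∑< (suc n) β in K≡
... | zero = z≤n
... | K@(suc _) = ≤sq-of-large (K * (t * t)) S C y large (begin
    K * (t * t) * (y * y)               ≤⟨ *-monoʳ-≤ (K * (t * t)) (isqrt-sq≤ (K * (M * M))) ⟩
    K * (t * t) * (K * (M * M))         ≡⟨ eq₁ K t M ⟩
    (t * (K * M)) * (t * (K * M))       ≤⟨ *-mono-≤ main main ⟩
    (S * y + C) * (S * y + C)           ∎)
  where
  open ≤-Reasoning
  d = suc d′
  open Path q d
  open Dominates
  F G S t C₀ C M y R E : ℕ
  F = ∑< (suc m) α
  G = ∑< (suc n) β
  S = ∑< (suc (suc (m + n))) N
  t = p + q
  E = (2 + p) * suc (m + n)
  C₀ = E + p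
  -- Replacing `y` by its successor `R` adds a further `S` to the error `C₀`.
  C = S + C₀
  M = suc (2 * S * C + C * C)
  -- Products of masses grow by the factor K M², so `N` is multiplied by the upper bound `R` of its
  -- root to preserve domination.
  y = isqrt (K * (M * M))
  R = suc y
  α′ β′ X : ℕ → ℕ
  α′ i = α i * (G * M)
  β′ j = β j * (F * M)
  X k = N k * R
  large : 2 * S * C + C * C < y
  large = sq≤⇒≤isqrt (m≤n*m (M * M) K)
  eq₁ : ∀ K t M → K * (t * t) * (K * (M * M)) ≡ (t * (K * M)) * (t * (K * M))
  eq₁ = solve-∀
  scale : ∀ r i j x → (r * r) * (α i * β j) ≤ x * x → (r * r) * (α′ i * β′ j) ≤ (x * R) * (x * R)
  scale r i j x h = begin
    (r * r) * (α′ i * β′ j)                       ≡⟨ eq r (α i) (β j) F G M ⟩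
    (r * r) * (α i * β j) * (F * G * (M * M))     ≡⟨ cong (λ z → (r * r) * (α i * β j) * (z * (M * M))) K≡ ⟩
    (r * r) * (α i * β j) * (K * (M * M))         ≤⟨ *-mono-≤ h (<⇒≤ (<-suc-isqrt-sq (K * (M * M)))) ⟩
    (x * x) * (R * R)                             ≡⟨ eq′ x R ⟩
    (x * R) * (x * R)                             ∎
    where
    eq : ∀ r a b F G M → (r * r) * (a * (G * M) * (b * (F * M))) ≡ (r * r) * (a * b) * (F * G * (M * M))
    eq = solve-∀
    eq′ : ∀ x R → (x * x) * (R * R) ≡ (x * R) * (x * R)
    eq′ = solve-∀
  D′ : Dominates p q α′ β′ X
  D′ = dom (λ i j → scale p i j (N (i + j)) (at D i j)) (λ i j → scale q i j (N (suc (i + j))) (at⁺ D i j))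
  mass-α : ∑< (suc m) α′ ≡ K * M
  mass-α = trans (∑<-*ʳ (suc m) α (G * M)) (trans (sym (*-assoc F G M)) (cong (_* M) K≡))
  mass-β : ∑< (suc n) β′ ≡ K * M
  mass-β = trans (∑<-*ʳ (suc n) β (F * M)) (trans (eq G F M) (cong (_* M) K≡))
    where
    eq : ∀ G F M → G * (F * M) ≡ F * G * M
    eq = solve-∀
  mix0 : ∀ a → mix a 0 ≡ (p * p) * a
  mix0 a = trans (cong (λ z → (p * p) * a + z) (*-zeroʳ (q * q))) (+-identityʳ ((p * p) * a))
  walk : c₀ * (K * M) + isqrt ((p * p) * α′ 0 * ((q * q) * β′ 0)) ≤
         isqrt ((p * p) * α′ 0 * ((p * p) * β′ 0)) + d * ∑< (suc (m + n)) (X ∘ suc) + E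
  walk = subst₂ _≤_
    (cong₂ (λ z s → c₀ * z + isqrt s) mass-α (eq q p (α′ 0) (β′ 0)))
    (cong₂ (λ a b → isqrt (a * b) + d * ∑< (suc (m + n)) (X ∘ suc) + E) (mix0 (α′ 0)) (mix0 (β′ 0)))
    (path (m + n) m n refl α′ β′ X (α′ 0) 0 (β′ 0) 0 (sym (+-identityʳ _)) (sym (+-identityʳ _))
      (trans mass-α (sym mass-β)) D′)
    where
    eq : ∀ q p a b → (q * q) * a * ((p * p) * b) ≡ (p * p) * a * ((q * q) * b)
    eq = solve-∀
  total : c₀ * (K * M) ≤ d * (S * R) + C₀
  -- The boundary term of the first cell exceeds `r` by at most d X 0 + p, which supplies the
  -- summand X 0 missing from the path bound.
  total = +-cancelʳ-≤ r _ _ (begin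
    c₀ * (K * M) + r                                        ≤⟨ walk ⟩
    isqrt ((p * p) * α′ 0 * ((p * p) * β′ 0)) + d * T + E   ≤⟨ +-monoˡ-≤ E (+-monoˡ-≤ (d * T)
                                                                 (stretch ((p * p) * α′ 0) (β′ 0) (X 0)
                                                                   (≤-trans (≤-reflexive (*-assoc (p * p) (α′ 0) (β′ 0))) (at D′ 0 0)))) ⟩
    d * X 0 + r + p + d * T + E                             ≡⟨ eq d (X 0) r p T E ⟩
    d * (X 0 + T) + C₀ + r                                  ≡⟨ cong (λ z → d * z + C₀ + r) (∑<-*ʳ (suc (suc (m + n))) N R) ⟩
    d * (S * R) + C₀ + r                                    ∎)
    where
    r T : ℕ
    r = isqrt ((p * p) * α′ 0 * ((q * q) * β′ 0))
    T = ∑< (suc (m + n)) (X ∘ suc)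
    eq : ∀ d x r p T E → d * x + r + p + d * T + E ≡ d * (x + T) + (E + p) + r
    eq = solve-∀
  main : t * (K * M) ≤ S * y + C
  -- Here `d` is cancelled, so it has to be nonzero; equal weights are reached by a limit instead.
  main = *-cancelˡ-≤ d (begin
    d * (t * (K * M))      ≡⟨ *-assoc d t (K * M) ⟨
    c₀ * (K * M)           ≤⟨ total ⟩
    d * (S * R) + C₀       ≤⟨ +-monoʳ-≤ (d * (S * R)) (m≤n*m C₀ d) ⟩
    d * (S * R) + d * C₀   ≡⟨ eq d S y C₀ ⟩
    d * (S * y + C)        ∎)
    where
    eq : ∀ d S y C → d * (S * suc y) + d * C ≡ d * (S * y + (S + C))
    eq = solve-∀

-- The limit M → ∞ of the case of the distinct weights p (M + 1) and p M.
weighted-sum-≡ : ∀ p → WeightedSum p p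
weighted-sum-≡ zero m n α β N D = ≤-trans (≤-reflexive (*-zeroʳ (∑< (suc m) α * ∑< (suc n) β))) z≤n
weighted-sum-≡ p@(suc _) m n α β N D = ≤sq-of-large (K * ((p + p) * (p + p))) S S M (n<1+n _) (begin
    K * ((p + p) * (p + p)) * (M * M)                                  ≡⟨ eq₁ K p M ⟩
    K * ((p * M + p * M) * (p * M + p * M))                            ≤⟨ *-monoʳ-≤ K (*-mono-≤ t≤ t≤) ⟩
    K * ((p * M + p + p * M) * (p * M + p + p * M))                    ≤⟨ weighted-sum-< (p * M) _ m n α β (λ k → N k * suc M) D′ ⟩
    ∑< L (λ k → N k * suc M) * ∑< L (λ k → N k * suc M)                ≡⟨ cong (λ z → z * z) (trans (∑<-*ʳ L N (suc M)) (eq₂ S M)) ⟩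
    (S * M + S) * (S * M + S)                                          ∎)
  where
  open ≤-Reasoning
  open Dominates
  L K S M : ℕ
  L = suc (suc (m + n))
  K = ∑< (suc m) α * ∑< (suc n) β
  S = ∑< L N
  M = suc (2 * S * S + S * S)
  eq₁ : ∀ K p M → K * ((p + p) * (p + p)) * (M * M) ≡ K * ((p * M + p * M) * (p * M + p * M))
  eq₁ = solve-∀
  eq₂ : ∀ S M → S * suc M ≡ S * M + S
  eq₂ = solve-∀
  t≤ : p * M + p * M ≤ p * M + p + p * M
  t≤ = +-monoˡ-≤ (p * M) (m≤m+n (p * M) p)
  scale : ∀ r a x → r ≤ p * suc M → (p * p) * a ≤ x * x → (r * r) * a ≤ (x * suc M) * (x * suc M)
  scale r a x r≤ h = begin
    (r * r) * a                               ≤⟨ *-monoˡ-≤ a (*-mono-≤ r≤ r≤) ⟩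
    (p * suc M) * (p * suc M) * a             ≡⟨ eq p (suc M) a ⟩
    (p * p) * a * (suc M * suc M)             ≤⟨ *-monoˡ-≤ (suc M * suc M) h ⟩
    (x * x) * (suc M * suc M)                 ≡⟨ eq′ x (suc M) ⟩
    (x * suc M) * (x * suc M)                 ∎
    where
    eq : ∀ p m a → (p * m) * (p * m) * a ≡ (p * p) * a * (m * m)
    eq = solve-∀
    eq′ : ∀ x m → (x * x) * (m * m) ≡ (x * m) * (x * m)
    eq′ = solve-∀
  D′ : Dominates (p * M + p) (p * M) α β (λ k → N k * suc M)
  D′ = dom (λ i j → scale (p * M + p) (α i * β j) (N (i + j)) (≤-reflexive (sym (eq₂ p M))) (at D i j))
           (λ i j → scale (p * M) (α i * β j) (N (suc (i + j))) (*-monoʳ-≤ p (n≤1+n M)) (at⁺ D i j))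

weighted-sum : ∀ {p q} → q ≤ p → WeightedSum p q
weighted-sum {p} {q} q≤p with m≤n⇒∃[o]m+o≡n q≤p
... | zero , refl = subst (λ p → WeightedSum p q) (sym (+-identityʳ q)) (weighted-sum-≡ q)
... | suc d , refl = weighted-sum-< q d

-- Sums over lists and the combination of residue classes

∑ : ∀ {A : Set} → List A → (A → ℕ) → ℕ
∑ xs f = sum (map f xs)

∑-++ : ∀ {A : Set} xs ys (f : A → ℕ) → ∑ (xs ++ ys) f ≡ ∑ xs f + ∑ ys f
∑-++ xs ys f = trans (cong sum (ListP.map-++ f xs ys)) (sum-++ (map f xs) (map f ys))

∑-∘ : ∀ {A B : Set} xs (g : A → B) (f : B → ℕ) → ∑ (map g xs) f ≡ ∑ xs (f ∘ g)
∑-∘ xs g f = cong sum (sym (ListP.map-∘ xs))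

∑-upTo : ∀ n f → ∑ (upTo n) f ≡ ∑< n f
∑-upTo n f = cong sum (ListP.map-applyUpTo id f n)

∑-cong : ∀ {A : Set} xs {f g : A → ℕ} → (∀ x → f x ≡ g x) → ∑ xs f ≡ ∑ xs g
∑-cong xs h = cong sum (ListP.map-cong h xs)

∑-cartesianProductWith : ∀ {A B C : Set} (h : A → B → C) xs ys f →
  ∑ (cartesianProductWith h xs ys) f ≡ ∑ xs (λ x → ∑ ys (f ∘ h x))
∑-cartesianProductWith h [] ys f = refl
∑-cartesianProductWith h (x ∷ xs) ys f = trans
  (∑-++ (map (h x) ys) (cartesianProductWith h xs ys) f)
  (cong₂ _+_ (∑-∘ ys (h x) f) (∑-cartesianProductWith h xs ys f))

∈⇒≤∑ : ∀ {A : Set} {x : A} {xs} (f : A → ℕ) → x ∈ xs → f x ≤ ∑ xs f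
∈⇒≤∑ f (here refl) = m≤m+n _ _
∈⇒≤∑ {xs = y ∷ xs} f (there x∈xs) = ≤-trans (∈⇒≤∑ f x∈xs) (m≤n+m (∑ xs f) (f y))

∑-zero : ∀ {A : Set} {xs : List A} {f} → All (λ x → f x ≤ 0) xs → ∑ xs f ≡ 0
∑-zero [] = refl
∑-zero (h ∷ hs) = cong₂ _+_ (n≤0⇒n≡0 h) (∑-zero hs)

-- The hypotheses say √w f ≤ √u s and √w g ≤ √u r, and these are added; their product bounds the
-- mixed term.
sq-≤-+ : ∀ w u f s g r → w * (f * f) ≤ u * (s * s) → w * (g * g) ≤ u * (r * r) →
  w * ((f + g) * (f + g)) ≤ u * ((s + r) * (s + r))
sq-≤-+ w u f s g r hf hg = begin
  w * ((f + g) * (f + g))                              ≡⟨ eq w f g ⟩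
  w * (f * f) + w * (g * g) + 2 * (w * (f * g))        ≤⟨ +-mono-≤ (+-mono-≤ hf hg) (*-monoʳ-≤ 2 cross) ⟩
  u * (s * s) + u * (r * r) + 2 * (u * (s * r))        ≡⟨ eq u s r ⟨
  u * ((s + r) * (s + r))                              ∎
  where
  open ≤-Reasoning
  eq : ∀ w f g → w * ((f + g) * (f + g)) ≡ w * (f * f) + w * (g * g) + 2 * (w * (f * g))
  eq = solve-∀
  eq′ : ∀ w f g → (w * (f * g)) * (w * (f * g)) ≡ w * (f * f) * (w * (g * g))
  eq′ = solve-∀
  cross : w * (f * g) ≤ u * (s * r)
  cross = sq-cancel-≤ (subst₂ _≤_ (sym (eq′ w f g)) (sym (eq′ u s r)) (*-mono-≤ hf hg))

∑-sq-≤ : ∀ {A : Set} {xs : List A} w u f s → All (λ x → w * (f x * f x) ≤ u * (s x * s x)) xs →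
  w * (∑ xs f * ∑ xs f) ≤ u * (∑ xs s * ∑ xs s)
∑-sq-≤ w u f s [] = ≤-trans (≤-reflexive (*-zeroʳ w)) z≤n
∑-sq-≤ {xs = x ∷ xs} w u f s (h ∷ hs) =
  sq-≤-+ w u (f x) (s x) (∑ xs f) (∑ xs s) h (∑-sq-≤ w u f s hs)

≤-argmax : ∀ {A : Set} (f : A → ℕ) x xs → All (λ y → f y ≤ f (argmax f x xs)) (x ∷ xs)
≤-argmax f x xs = f[⊥]≤f[argmax] {f = f} x xs ∷ f[xs]≤f[argmax] {f = f} x xs

-- With F and G maximal at x* and y*, a column sum bounds S² F(x*) below by W (∑ F)² G(y*) and
-- a row sum bounds S² G(y*) below by W (∑ G)² F(x*); the product of the two bounds is the claim squared.
∑-convolution-bound : ∀ {A : Set} (xs : List A) (F G : A → ℕ) (s : A → A → ℕ) (S W : ℕ) →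
  (∀ x y → F x * G y * W ≤ s x y * s x y) →
  (∀ y → ∑ xs (λ x → s x y) ≤ S) → (∀ x → ∑ xs (s x) ≤ S) →
  ∑ xs F * ∑ xs G * W ≤ S * S
∑-convolution-bound [] F G s S W h col row = z≤n
∑-convolution-bound xs@(x₀ ∷ xs′) F G s S W h col row
  with F (argmax F x₀ xs′) in F*≡ | G (argmax G x₀ xs′) in G*≡
-- A zero maximum makes the whole sum vanish; otherwise the product of the two maxima can be
-- cancelled.
... | zero | _ = ≤-trans (≤-reflexive (cong (λ z → z * ∑ xs G * W)
  (∑-zero (subst (λ z → All (λ x → F x ≤ z) xs) F*≡ (≤-argmax F x₀ xs′))))) z≤n
... | suc _ | zero = ≤-trans (≤-reflexive (trans
  (cong (λ z → ∑ xs F * z * W) (∑-zero (subst (λ z → All (λ x → G x ≤ z) xs) G*≡ (≤-argmax G x₀ xs′))))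
  (cong (_* W) (*-zeroʳ (∑ xs F))))) z≤n
... | F*@(suc _) | G*@(suc _) = sq-cancel-≤ (*-cancelˡ-≤ (F* * G*) (begin
  F* * G* * ((ΣF * ΣG * W) * (ΣF * ΣG * W))          ≡⟨ eq F* G* ΣF ΣG W ⟩
  (W * G*) * (ΣF * ΣF) * ((W * F*) * (ΣG * ΣG))      ≤⟨ *-mono-≤ byF byG ⟩
  F* * (S * S) * (G* * (S * S))                      ≡⟨ eq′ F* G* (S * S) ⟩
  F* * G* * ((S * S) * (S * S))                      ∎))
  where
  open ≤-Reasoning
  ΣF = ∑ xs F
  ΣG = ∑ xs G
  x* = argmax F x₀ xs′
  y* = argmax G x₀ xs′
  eq : ∀ a b F G W → a * b * ((F * G * W) * (F * G * W)) ≡ (W * b) * (F * F) * ((W * a) * (G * G))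
  eq = solve-∀
  eq′ : ∀ a b s → a * s * (b * s) ≡ a * b * (s * s)
  eq′ = solve-∀
  eq₁ : ∀ W b f → (W * b) * (f * f) ≡ f * (f * b * W)
  eq₁ = solve-∀
  eq₂ : ∀ W a g → (W * a) * (g * g) ≡ g * (a * g * W)
  eq₂ = solve-∀
  byF : (W * G*) * (ΣF * ΣF) ≤ F* * (S * S)
  byF = ≤-trans (∑-sq-≤ (W * G*) F* F (λ x → s x y*) (All.map (λ {x} Fx≤ → begin
      (W * G*) * (F x * F x)        ≡⟨ eq₁ W G* (F x) ⟩
      F x * (F x * G* * W)          ≡⟨ cong (λ z → F x * (F x * z * W)) G*≡ ⟨
      F x * (F x * G y* * W)        ≤⟨ *-mono-≤ (subst (F x ≤_) F*≡ Fx≤) (h x y*) ⟩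
      F* * (s x y* * s x y*)        ∎)
      (≤-argmax F x₀ xs′)))
    (*-monoʳ-≤ F* (*-mono-≤ (col y*) (col y*)))
  byG : (W * F*) * (ΣG * ΣG) ≤ G* * (S * S)
  byG = ≤-trans (∑-sq-≤ (W * F*) G* G (s x*) (All.map (λ {y} Gy≤ → begin
      (W * F*) * (G y * G y)        ≡⟨ eq₂ W F* (G y) ⟩
      G y * (F* * G y * W)          ≡⟨ cong (λ z → G y * (z * G y * W)) F*≡ ⟨
      G y * (F x* * G y * W)        ≤⟨ *-mono-≤ (subst (G y ≤_) G*≡ Gy≤) (h x* y) ⟩
      G* * (s x* y * s x* y)        ∎)
      (≤-argmax G x₀ xs′)))
    (*-monoʳ-≤ G* (*-mono-≤ (row x*) (row x*)))

-- Cardinalities and fibres over the last coordinate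

Unique-⊆⇒length≤ : ∀ {A : Set} {xs ys : List A} → Unique xs → xs ⊆ ys → length xs ≤ length ys
Unique-⊆⇒length≤ [] sub = z≤n
Unique-⊆⇒length≤ {xs = x ∷ xs} (x∉xs ∷ uniq) sub with as , bs , refl ← ∈-∃++ (sub (here refl)) =
  ≤-trans (s≤s (Unique-⊆⇒length≤ uniq sub′)) (≤-reflexive (sym (ListP.length-++-sucʳ as x bs)))
  where
  sub′ : xs ⊆ as ++ bs
  sub′ z∈xs with ∈-++⁻ as (sub (there z∈xs))
  ... | inj₁ z∈as = ∈-++⁺ˡ z∈as
  ... | inj₂ (here refl) = contradiction refl (All.lookup x∉xs z∈xs)
  ... | inj₂ (there z∈bs) = ∈-++⁺ʳ as z∈bs

private variable
  dim : ℕ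

infix 4 _≟ᵖ_
_≟ᵖ_ : (v w : Point dim) → Dec (v ≡ w)
_≟ᵖ_ = VecP.≡-dec ℤP._≟_

length≤card : {xs L : List (Point dim)} → Unique xs → xs ⊆ L → length xs ≤ card L
length≤card uniq sub = Unique-⊆⇒length≤ uniq (∈-deduplicate⁺ _≟ᵖ_ ∘ sub)

card≤length : {xs L : List (Point dim)} → L ⊆ xs → card L ≤ length xs
card≤length {L = L} sub = Unique-⊆⇒length≤ (deduplicate-! _≟ᵖ_ L) (sub ∘ ∈-deduplicate⁻ _≟ᵖ_ L)

card-mono : {L L′ : List (Point dim)} → L ⊆ L′ → card L ≤ card L′
card-mono {L = L} sub = length≤card (deduplicate-! _≟ᵖ_ L) (sub ∘ ∈-deduplicate⁻ _≟ᵖ_ L)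

fibre : ℤ → List (Point (suc dim)) → List (Point dim)
fibre x L = map init (filter (λ v → last v ℤP.≟ x) L)

∈-fibre⁺ : ∀ {x} {w : Point dim} L → w ∷ʳ x ∈ L → w ∈ fibre x L
∈-fibre⁺ {x = x} {w} L h = subst (_∈ fibre x L) (VecP.init-∷ʳ x w)
  (∈-map⁺ init (∈-filter⁺ (λ v → last v ℤP.≟ x) h (VecP.last-∷ʳ x w)))

∈-fibre⁻ : ∀ {x} {w : Point dim} L → w ∈ fibre x L → w ∷ʳ x ∈ L
∈-fibre⁻ {x = x} L h with v , v∈ , refl ← ∈-map⁻ init h
  with v∈L , refl ← ∈-filter⁻ (λ v → last v ℤP.≟ x) {xs = L} v∈ =
  subst (_∈ L) (proj₂ (proj₂ (initLast v))) v∈L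

-- The points of `L` over `xs`, listed fibre by fibre; free of repetitions when `xs` is, so that its
-- length links `card L` to the cardinalities of the fibres.
slices : List ℤ → List (Point (suc dim)) → List (Point (suc dim))
slices [] L = []
slices (x ∷ xs) L = map (_∷ʳ x) (deduplicate _≟ᵖ_ (fibre x L)) ++ slices xs L

length-slices : ∀ xs (L : List (Point (suc dim))) → length (slices xs L) ≡ ∑ xs (λ x → card (fibre x L))
length-slices [] L = refl
length-slices (x ∷ xs) L = trans (ListP.length-++ (map (_∷ʳ x) (deduplicate _≟ᵖ_ (fibre x L))))
  (cong₂ _+_ (ListP.length-map (_∷ʳ x) (deduplicate _≟ᵖ_ (fibre x L))) (length-slices xs L))

∈-slices⁻ : ∀ xs {L} {v : Point (suc dim)} → v ∈ slices xs L → last v ∈ xs × v ∈ L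
∈-slices⁻ (x ∷ xs) {L} h with ∈-++⁻ (map (_∷ʳ x) (deduplicate _≟ᵖ_ (fibre x L))) h
... | inj₁ h₁ with w , w∈ , refl ← ∈-map⁻ (_∷ʳ x) h₁ =
  here (VecP.last-∷ʳ x w) , ∈-fibre⁻ L (∈-deduplicate⁻ _≟ᵖ_ (fibre x L) w∈)
... | inj₂ h₂ with l∈ , v∈ ← ∈-slices⁻ xs h₂ = there l∈ , v∈

∈-slices⁺ : ∀ {xs L} {w : Point dim} {x} → x ∈ xs → w ∷ʳ x ∈ L → w ∷ʳ x ∈ slices xs L
∈-slices⁺ {L = L} {x = x} (here refl) h = ∈-++⁺ˡ (∈-map⁺ (_∷ʳ x) (∈-deduplicate⁺ _≟ᵖ_ (∈-fibre⁺ L h)))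
∈-slices⁺ {xs = y ∷ xs} {L} (there x∈) h = ∈-++⁺ʳ (map (_∷ʳ y) (deduplicate _≟ᵖ_ (fibre y L))) (∈-slices⁺ x∈ h)

slices-! : ∀ {xs} (L : List (Point (suc dim))) → Unique xs → Unique (slices xs L)
slices-! L [] = []
slices-! {xs = x ∷ xs} L (x∉xs ∷ uniq) = ++⁺
  (map⁺ (λ {v} {w} → VecP.∷ʳ-injectiveˡ v w) (deduplicate-! _≟ᵖ_ (fibre x L)))
  (slices-! L uniq)
  λ (h₁ , h₂) → let w , _ , v≡ = ∈-map⁻ (_∷ʳ x) h₁ in
    All.lookup x∉xs (subst (_∈ xs) (trans (cong last v≡) (VecP.last-∷ʳ x w)) (proj₁ (∈-slices⁻ xs h₂))) refl

∑-card-fibre≤card : ∀ {xs} (L : List (Point (suc dim))) → Unique xs → ∑ xs (λ x → card (fibre x L)) ≤ card L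
∑-card-fibre≤card {xs = xs} L uniq = ≤-trans (≤-reflexive (sym (length-slices xs L)))
  (length≤card (slices-! L uniq) (proj₂ ∘ ∈-slices⁻ xs))

card≤∑-card-fibre : ∀ {xs} (L : List (Point (suc dim))) → (∀ {v} → v ∈ L → last v ∈ xs) → card L ≤ ∑ xs (λ x → card (fibre x L))
card≤∑-card-fibre {xs = xs} L cover = ≤-trans
  (card≤length (λ {v} v∈ → let eq = proj₂ (proj₂ (initLast v)) in
    subst (_∈ slices xs L) (sym eq) (∈-slices⁺ (cover v∈) (subst (_∈ L) eq v∈))))
  (≤-reflexive (length-slices xs L))

∷ʳ-⊕ : ∀ (v w : Point dim) x y → (v ∷ʳ x) ⊕ (w ∷ʳ y) ≡ (v ⊕ w) ∷ʳ (x +ℤ y)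
∷ʳ-⊕ [] [] x y = refl
∷ʳ-⊕ (_ ∷ v) (_ ∷ w) x y = cong (_ ∷_) (∷ʳ-⊕ v w x y)

sumset3-fibre-⊆ : ∀ (A B U : List (Point (suc dim))) x y z → sumset3 (fibre x A) (fibre y B) (fibre z U) ⊆ fibre (x +ℤ y +ℤ z) (sumset3 A B U)
sumset3-fibre-⊆ A B U x y z h
  with s , u , s∈ , u∈ , refl ← ∈-cartesianProductWith⁻ _⊕_ (cartesianProductWith _⊕_ (fibre x A) (fibre y B)) (fibre z U) h
  with a , b , a∈ , b∈ , refl ← ∈-cartesianProductWith⁻ _⊕_ (fibre x A) (fibre y B) s∈ =
  ∈-fibre⁺ (sumset3 A B U) (subst (_∈ sumset3 A B U)
    (trans (cong (_⊕ (u ∷ʳ z)) (∷ʳ-⊕ a b x y)) (∷ʳ-⊕ (a ⊕ b) u (x +ℤ y) z))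
    (∈-cartesianProductWith⁺ _⊕_ (∈-cartesianProductWith⁺ _⊕_ (∈-fibre⁻ A a∈) (∈-fibre⁻ B b∈)) (∈-fibre⁻ U u∈)))

-- Quantified over `A` and `B` because the induction uses it for every pair of their fibres.
SumsetBound : List (Point dim) → Set
SumsetBound U = ∀ A B → card A * card B * (card U * card U) ≤ card (sumset3 A B U) * card (sumset3 A B U)

-- Arithmetic progressions of a fixed difference

shift-nonneg : ∀ K z → ∣ z ∣ ≤ K → ∃ λ i → i < suc (K + K) × + i ≡ z +ℤ + K
shift-nonneg K (+ n) n≤K = n + K , s≤s (+-monoˡ-≤ K n≤K) , refl
shift-nonneg K ℤ.-[1+ n ] n<K = K ∸ suc n , s≤s (≤-trans (m∸n≤m K (suc n)) (m≤m+n K K)) , sym (ℤP.⊖-≥ n<K)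

-- point c ρ i is the i-th term of the progression of difference t with offset ρ, so that ρ ranges over
-- the residues modulo t.
module Progressions (t : ℤ) .{{_ : ℤ.NonZero t}} where

  point : ℤ → Fin ∣ t ∣ → ℕ → ℤ
  point c ρ i = c +ℤ + toℕ ρ +ℤ + i *ℤ t

  ∣point-diff∣ : ∀ c {ρ σ i j} → point c ρ i ≡ point c σ j →
    ∣ + toℕ ρ -ℤ + toℕ σ ∣ ≡ ∣ + j -ℤ + i ∣ * ∣ t ∣
  ∣point-diff∣ c {ρ} {σ} {i} {j} eq = begin
    ∣ r -ℤ s ∣                                            ≡⟨ cong ∣_∣ (eq₁ c r s (+ i) t) ⟩
    ∣ point c ρ i -ℤ (c +ℤ s +ℤ + i *ℤ t) ∣               ≡⟨ cong (λ z → ∣ z -ℤ (c +ℤ s +ℤ + i *ℤ t) ∣) eq ⟩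
    ∣ point c σ j -ℤ (c +ℤ s +ℤ + i *ℤ t) ∣               ≡⟨ cong ∣_∣ (eq₂ c s (+ i) (+ j) t) ⟩
    ∣ (+ j -ℤ + i) *ℤ t ∣                                 ≡⟨ ℤP.abs-* (+ j -ℤ + i) t ⟩
    ∣ + j -ℤ + i ∣ * ∣ t ∣                                ∎
    where
    open ≡-Reasoning
    r s : ℤ
    r = + toℕ ρ
    s = + toℕ σ
    eq₁ : ∀ c r s i t → r -ℤ s ≡ (c +ℤ r +ℤ i *ℤ t) -ℤ (c +ℤ s +ℤ i *ℤ t)
    eq₁ = ℤSolver.solve-∀
    eq₂ : ∀ c s i j t → (c +ℤ s +ℤ j *ℤ t) -ℤ (c +ℤ s +ℤ i *ℤ t) ≡ (j -ℤ i) *ℤ t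
    eq₂ = ℤSolver.solve-∀

  -- The offsets differ by a multiple of `t` but by less than its absolute value, so the multiple is
  -- zero.
  point-injective : ∀ c {ρ σ i j} → point c ρ i ≡ point c σ j → ρ ≡ σ × i ≡ j
  point-injective c {ρ} {σ} {i} {j} eq with ∣ + j -ℤ + i ∣ in gap
  ... | zero =
    FinP.toℕ-injective (ℤP.+-injective (ℤP.i-j≡0⇒i≡j (+ toℕ ρ) (+ toℕ σ)
      (ℤP.∣i∣≡0⇒i≡0 (trans (∣point-diff∣ c {ρ} {σ} {i} {j} eq) (cong (_* ∣ t ∣) gap)))))
    , sym (ℤP.+-injective (ℤP.i-j≡0⇒i≡j (+ j) (+ i) (ℤP.∣i∣≡0⇒i≡0 gap)))
  ... | suc g = contradiction (begin
      ∣ t ∣                       ≤⟨ m≤m+n ∣ t ∣ (g * ∣ t ∣) ⟩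
      suc g * ∣ t ∣               ≡⟨ cong (_* ∣ t ∣) gap ⟨
      ∣ + j -ℤ + i ∣ * ∣ t ∣      ≡⟨ ∣point-diff∣ c {ρ} {σ} {i} {j} eq ⟨
      ∣ + toℕ ρ -ℤ + toℕ σ ∣      ≡⟨ cong ∣_∣ (ℤP.[+m]-[+n]≡m⊖n (toℕ ρ) (toℕ σ)) ⟩
      ∣ toℕ ρ ℤ.⊖ toℕ σ ∣         ≤⟨ ℤP.∣m⊝n∣≤m⊔n (toℕ ρ) (toℕ σ) ⟩
      toℕ ρ ⊔ toℕ σ               ∎)
    (<⇒≱ (⊔-pres-<m (FinP.toℕ<n ρ) (FinP.toℕ<n σ)))
    where open ≤-Reasoning

  grid : ℤ → ℕ → List ℤ
  grid c n = cartesianProductWith (point c) (allFin ∣ t ∣) (upTo n)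

  grid-! : ∀ c n → Unique (grid c n)
  grid-! c n = cartesianProductWith⁺ (point c) (point-injective c) (allFin⁺ ∣ t ∣) (upTo⁺ n)

  ∑-grid : ∀ c n f → ∑ (grid c n) f ≡ ∑ (allFin ∣ t ∣) (λ ρ → ∑< n (f ∘ point c ρ))
  ∑-grid c n f = trans (∑-cartesianProductWith (point c) (allFin ∣ t ∣) (upTo n) f)
    (∑-cong (allFin ∣ t ∣) (λ ρ → ∑-upTo n (f ∘ point c ρ)))

  -- Starting at -K t turns the quotients from -K to K into the indices from 0 to 2K.
  base : ℕ → ℤ
  base K = ℤ.- (+ K *ℤ t)

  ∈-grid : ∀ K x → ∣ x ℤD./ t ∣ ≤ K → x ∈ grid (base K) (suc (K + K))
  ∈-grid K x small with i , i< , i≡ ← shift-nonneg K (x ℤD./ t) small =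
    subst (_∈ grid (base K) (suc (K + K))) point≡x
      (∈-cartesianProductWith⁺ (point (base K)) (∈-allFin ρ) (∈-upTo⁺ i<))
    where
    open ≡-Reasoning
    ρ : Fin ∣ t ∣
    ρ = fromℕ< (ℤD.n%d<d x t)
    eq : ∀ k r q t → ℤ.- (k *ℤ t) +ℤ r +ℤ (q +ℤ k) *ℤ t ≡ r +ℤ q *ℤ t
    eq = ℤSolver.solve-∀
    point≡x : point (base K) ρ i ≡ x
    point≡x = begin
      base K +ℤ + toℕ ρ +ℤ + i *ℤ t
        ≡⟨ cong₂ (λ r q → base K +ℤ + r +ℤ q *ℤ t) (FinP.toℕ-fromℕ< (ℤD.n%d<d x t)) i≡ ⟩
      base K +ℤ + (x ℤD.% t) +ℤ (x ℤD./ t +ℤ + K) *ℤ t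
        ≡⟨ eq (+ K) (+ (x ℤD.% t)) (x ℤD./ t) t ⟩
      + (x ℤD.% t) +ℤ (x ℤD./ t) *ℤ t
        ≡⟨ ℤD.a≡a%n+[a/n]*n x t ⟨
      x ∎

-- The induction on the dimension

module _ (U : List (Point (suc dim))) (x₀ x₁ : ℤ) (x₀≢x₁ : x₀ ≢ x₁)
  (ends : ∀ {v} → v ∈ U → last v ≡ x₀ ⊎ last v ≡ x₁) where

  card≤ends : card U ≤ card (fibre x₀ U) + card (fibre x₁ U)
  card≤ends = ≤-trans (card≤∑-card-fibre {xs = x₀ ∷ x₁ ∷ []} U cover)
    (≤-reflexive (cong (λ z → card (fibre x₀ U) + z) (+-identityʳ (card (fibre x₁ U)))))
    where
    cover : ∀ {v} → v ∈ U → last v ∈ x₀ ∷ x₁ ∷ []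
    cover v∈ with ends v∈
    ... | inj₁ eq = here eq
    ... | inj₂ eq = there (here eq)

  fibrewise : SumsetBound (fibre x₀ U) → SumsetBound (fibre x₁ U) →
    card (fibre x₁ U) ≤ card (fibre x₀ U) → SumsetBound U
  fibrewise bound₀ bound₁ q≤p A B = begin
    card A * card B * (card U * card U)              ≤⟨ *-mono-≤ (*-mono-≤ A≤ B≤) (*-mono-≤ card≤ends card≤ends) ⟩
    ∑ R F * ∑ R G * ((p + q) * (p + q))              ≤⟨ ∑-convolution-bound R F G s (card S) ((p + q) * (p + q)) bound column row ⟩
    card S * card S                                  ∎
    where
    open ≤-Reasoning
    t : ℤ
    t = x₁ -ℤ x₀
    instance
      t≢0 : ℤ.NonZero t
      t≢0 = ℤ.≢-nonZero (λ eq → x₀≢x₁ (sym (ℤP.i-j≡0⇒i≡j x₁ x₀ eq)))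
    open Progressions t
    R : List (Fin ∣ t ∣)
    R = allFin ∣ t ∣
    quotient : Point (suc dim) → ℕ
    quotient v = ∣ last v ℤD./ t ∣
    p q K m : ℕ
    p = card (fibre x₀ U)
    q = card (fibre x₁ U)
    -- The sum is a convenient upper bound for each single quotient.
    K = ∑ A quotient + ∑ B quotient
    m = K + K
    c : ℤ
    c = base K
    S : List (Point (suc dim))
    S = sumset3 A B U
    α β : Fin ∣ t ∣ → ℕ → ℕ
    α ρ i = card (fibre (point c ρ i) A)
    β σ j = card (fibre (point c σ j) B)
    N : Fin ∣ t ∣ → Fin ∣ t ∣ → ℕ → ℕ
    -- Offsets may add up to more than one period, so `σ` is moved into the base point: for fixed
    -- `σ` the values for all `ρ` run through one grid, and symmetrically for fixed `ρ`.
    N ρ σ k = card (fibre (point (x₀ +ℤ c +ℤ c +ℤ + toℕ σ) ρ k) S)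
    F G : Fin ∣ t ∣ → ℕ
    F ρ = ∑< (suc m) (α ρ)
    G σ = ∑< (suc m) (β σ)
    s : Fin ∣ t ∣ → Fin ∣ t ∣ → ℕ
    s ρ σ = ∑< (suc (suc (m + m))) (N ρ σ)
    A≤ : card A ≤ ∑ R F
    A≤ = ≤-trans
      (card≤∑-card-fibre A (λ {v} v∈ → ∈-grid K (last v) (≤-trans (∈⇒≤∑ quotient v∈) (m≤m+n _ _))))
      (≤-reflexive (∑-grid c (suc m) (λ x → card (fibre x A))))
    B≤ : card B ≤ ∑ R G
    B≤ = ≤-trans
      (card≤∑-card-fibre B (λ {v} v∈ → ∈-grid K (last v) (≤-trans (∈⇒≤∑ quotient v∈) (m≤n+m _ (∑ A quotient)))))
      (≤-reflexive (∑-grid c (suc m) (λ x → card (fibre x B))))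
    ∑-grid≤ : ∀ c′ → ∑ R (λ ρ → ∑< (suc (suc (m + m))) (λ k → card (fibre (point c′ ρ k) S))) ≤ card S
    ∑-grid≤ c′ = ≤-trans (≤-reflexive (sym (∑-grid c′ (suc (suc (m + m))) (λ x → card (fibre x S)))))
      (∑-card-fibre≤card S (grid-! c′ (suc (suc (m + m)))))
    column : ∀ σ → ∑ R (λ ρ → s ρ σ) ≤ card S
    column σ = ∑-grid≤ (x₀ +ℤ c +ℤ c +ℤ + toℕ σ)
    row : ∀ ρ → ∑ R (s ρ) ≤ card S
    row ρ = ≤-trans
      (≤-reflexive (∑-cong R (λ σ → ∑<-cong (suc (suc (m + m))) (λ k →
        cong (λ x → card (fibre x S)) (eq (x₀ +ℤ c +ℤ c) (+ toℕ σ) (+ toℕ ρ) (+ k *ℤ t))))))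
      (∑-grid≤ (x₀ +ℤ c +ℤ c +ℤ + toℕ ρ))
      where
      eq : ∀ c x y z → c +ℤ x +ℤ y +ℤ z ≡ c +ℤ y +ℤ x +ℤ z
      eq = ℤSolver.solve-∀
    fibre-bound : ∀ x y z {w} → SumsetBound (fibre z U) → x +ℤ y +ℤ z ≡ w →
      card (fibre z U) * card (fibre z U) * (card (fibre x A) * card (fibre y B)) ≤
      card (fibre w S) * card (fibre w S)
    fibre-bound x y z bound-z refl = begin
      u * u * (card (fibre x A) * card (fibre y B))    ≡⟨ *-comm (u * u) _ ⟩
      card (fibre x A) * card (fibre y B) * (u * u)    ≤⟨ bound-z (fibre x A) (fibre y B) ⟩
      card S′ * card S′                                ≤⟨ *-mono-≤ S′≤ S′≤ ⟩
      card (fibre (x +ℤ y +ℤ z) S) * card (fibre (x +ℤ y +ℤ z) S) ∎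
      where
      u : ℕ
      u = card (fibre z U)
      S′ : List (Point dim)
      S′ = sumset3 (fibre x A) (fibre y B) (fibre z U)
      S′≤ : card S′ ≤ card (fibre (x +ℤ y +ℤ z) S)
      S′≤ = card-mono (sumset3-fibre-⊆ A B U x y z)
    bound : ∀ ρ σ → F ρ * G σ * ((p + q) * (p + q)) ≤ s ρ σ * s ρ σ
    -- As x₁ = x₀ + t, the fibre over `x₁` lands one index further than that over `x₀`.
    bound ρ σ = weighted-sum q≤p m m (α ρ) (β σ) (N ρ σ) (dom
      (λ i j → fibre-bound (point c ρ i) (point c σ j) x₀ bound₀ (eq₀ c (+ toℕ ρ) (+ i) (+ toℕ σ) (+ j) x₀ t))
      (λ i j → fibre-bound (point c ρ i) (point c σ j) x₁ bound₁ (eq₁ c (+ toℕ ρ) (+ i) (+ toℕ σ) (+ j) x₀ x₁)))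
      where
      eq₀ : ∀ c r i s j x t → c +ℤ r +ℤ i *ℤ t +ℤ (c +ℤ s +ℤ j *ℤ t) +ℤ x ≡ x +ℤ c +ℤ c +ℤ s +ℤ r +ℤ (i +ℤ j) *ℤ t
      eq₀ = ℤSolver.solve-∀
      eq₁ : ∀ c r i s j x y → c +ℤ r +ℤ i *ℤ (y -ℤ x) +ℤ (c +ℤ s +ℤ j *ℤ (y -ℤ x)) +ℤ y ≡
        x +ℤ c +ℤ c +ℤ s +ℤ r +ℤ (+ 1 +ℤ (i +ℤ j)) *ℤ (y -ℤ x)
      eq₁ = ℤSolver.solve-∀

-- The larger fibre is put first. Exchanging the ends changes the sign of the difference, so
-- progressions of negative difference occur.
two-ends : ∀ (U : List (Point (suc dim))) x₀ x₁ → x₀ ≢ x₁ →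
  (∀ {v} → v ∈ U → last v ≡ x₀ ⊎ last v ≡ x₁) →
  SumsetBound (fibre x₀ U) → SumsetBound (fibre x₁ U) → SumsetBound U
two-ends U x₀ x₁ x₀≢x₁ ends bound₀ bound₁ with ≤-total (card (fibre x₁ U)) (card (fibre x₀ U))
... | inj₁ q≤p = fibrewise U x₀ x₁ x₀≢x₁ ends bound₀ bound₁ q≤p
... | inj₂ p≤q = fibrewise U x₁ x₀ (x₀≢x₁ ∘ sym) (swap ∘ ends) bound₁ bound₀ p≤q

-- Starting from dimension zero, where a set has at most one point, makes dimension one an instance
-- of `two-ends`.
sumsetBound₀ : (U : List (Point 0)) → SumsetBound U
sumsetBound₀ U [] B = z≤n
sumsetBound₀ U A@(_ ∷ _) [] = ≤-trans (≤-reflexive (cong (_* (card U * card U)) (*-zeroʳ (card A)))) z≤n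
sumsetBound₀ [] A@(_ ∷ _) B@(_ ∷ _) = ≤-trans (≤-reflexive (*-zeroʳ (card A * card B))) z≤n
sumsetBound₀ U@(_ ∷ _) A@(_ ∷ _) B@(_ ∷ _) =
  ≤-trans (*-mono-≤ (*-mono-≤ (card≤1 A) (card≤1 B)) (*-mono-≤ (card≤1 U) (card≤1 U))) (s≤s z≤n)
  where
  card≤1 : (L : List (Point 0)) → card L ≤ 1
  card≤1 L = card≤length {xs = [] ∷ []} {L = L} λ { {[]} _ → here refl }

theorem1p1 : (n : ℕ) (A B U : List (Point (suc n))) (Q : Point (suc n) → Set) →
    Quasicube n Q → All Q U →
    card A * card B * (card U * card U) ≤ card (sumset3 A B U) * card (sumset3 A B U)
theorem1p1 zero A B U Q (x₀ , x₁ , x₀≢x₁ , char) Q-U =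
  two-ends U x₀ x₁ x₀≢x₁ ends (sumsetBound₀ (fibre x₀ U)) (sumsetBound₀ (fibre x₁ U)) A B
  where
  ends : ∀ {v} → v ∈ U → last v ≡ x₀ ⊎ last v ≡ x₁
  -- With a single coordinate, `head` and `last` coincide.
  ends {_ ∷ []} v∈ = proj₁ (char _) (All.lookup Q-U v∈)
theorem1p1 (suc n) A B U Q (x₀ , x₁ , x₀≢x₁ , ends , _ , _ , cube₀ , cube₁) Q-U =
  two-ends U x₀ x₁ x₀≢x₁ (ends _ ∘ All.lookup Q-U)
    (λ A′ B′ → theorem1p1 n A′ B′ (fibre x₀ U) _ cube₀ (All.tabulate (All.lookup Q-U ∘ ∈-fibre⁻ U)))
    (λ A′ B′ → theorem1p1 n A′ B′ (fibre x₁ U) _ cube₁ (All.tabulate (All.lookup Q-U ∘ ∈-fibre⁻ U)))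
    A B
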